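{- Let $\Sigma_1$ and $\Sigma_2$ be two signed graphs, with $\Sigma_2$ having at least one negative edge. Then the HG-lexicographic product satisfies $\operatorname{bdim}(\Sigma_1[\Sigma_2])\geq 3$.
   Context: A signed graph $\Sigma=(G,\sigma)$ is a graph $G=(V,E)$ with a function $\sigma:E\to\{+1,-1\}$. All graphs and signed graphs are finite, simple, connected and undirected unless otherwise mentioned. Let $\Omega=\{ -1,0,1\}$, with $\Omega^k\subset\mathbb{R}^k$ carrying the standard inner product $\langle\cdot,\cdot\rangle$. A vector valued switching function ($k$-switching function) for $\Sigma$ is a map $\zeta:V\to\Omega^k$ with $\langle\zeta(u),\zeta(v)\rangle\neq 0$ for every edge $uv\in E$; the switched signed graph $\Sigma^\zeta=(G,\sigma^\zeta)$ has $\sigma^\zeta(uv)=\sigma(uv)\operatorname{sgn}(\langle\zeta(u),\zeta(v)\rangle)$. The balancing dimension $\operatorname{bdim}(\Sigma)$ is the least integer $k\ge 1$ for which there is a $k$-switching function $\zeta:V\to\Omega^k$ such that $\Sigma^\zeta$ is all-positive (every edge has sign $+1$). The lexicographic product $G_1[G_2]$ of graphs has vertex set $V(G_1)\times V(G_2)$, with $(u_i,v_j)$ adjacent to $(u_k,v_l)$ iff $u_i\sim u_k$ in $G_1$, or $u_i=u_k$ and $v_j\sim v_l$ in $G_2$. The HG-lexicographic product $\Sigma_1[\Sigma_2]$ of $\Sigma_1=(G_1,\sigma_1)$ and $\Sigma_2=(G_2,\sigma_2)$ is the signed graph on $G_1[G_2]$ with signature $\sigma((u_i,v_j)(u_k,v_l))=\sigma_1(u_iu_k)$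 if $i\ne k$, and $=\sigma_2(v_jv_l)$ if $i=k$.
   Formalization: The formal theorem assumes that Σ₁ has at least two vertices; for a one-vertex Σ₁ the product is Σ₂ itself, and the claim fails when Σ₂ is a single negative edge, whose balancing dimension is 1. -}

module Defs where

open import Data.Empty using (⊥-elim)
open import Data.Fin using (Fin)
import Data.Fin.Properties as Fin
open import Data.Integer as ℤ using (ℤ; 0ℤ; 1ℤ; -1ℤ; sign; _◃_)
import Data.Integer.Properties as ℤ
open import Data.List using (List; []; _∷_; length; map; allFin; cartesianProduct)
open import Data.List.Membership.Propositional using (_∈_)
open import Data.List.Membership.Propositional.Properties
  using (∈-map⁺; ∈-allFin; ∈-cartesianProduct⁺)
open import Data.List.Relation.Unary.Any using (here; there)
open import Data.Nat as ℕ using (ℕ; zero; suc; _≤_; z≤n; s≤s)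
import Data.Nat.Properties as ℕ
open import Data.Product using (Σ-syntax; ∃; ∃-syntax; _×_; _,_; proj₁; proj₂)
open import Data.Product.Function.NonDependent.Propositional using (_×-↔_)
open import Data.Sign using (Sign; _*_)
import Data.Sign.Properties as Sign
open import Data.Sum using (_⊎_; inj₁; inj₂)
open import Data.Vec using (Vec; []; _∷_; lookup; tabulate)
open import Data.Vec.Properties using (lookup∘tabulate)
open import Function using (_∘_; _↔_; Inverse)
open import Function.Construct.Composition using (_↔-∘_)
open import Function.Construct.Symmetry using (↔-sym)
open import Function.Properties.Inverse using (↔⇒↣)
open import Relation.Binary using (Symmetric; Irreflexive; DecidableEquality)
import Relation.Binary as B
open import Relation.Binary.Construct.Closure.ReflexiveTransitive using (Star)
open import Relation.Binary.PropositionalEquality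
open import Relation.Nullary using (Dec; yes; no; ¬_; ¬?)
open import Relation.Nullary.Decidable using (map′; _×-dec_; _⊎-dec_)
open import Relation.Unary using (Decidable)

------------------------------------------------------------------------
-- Graphs and signed graphs

record Graph : Set₁ where
  infix 4 _~_ _~?_ _≟_
  field
    V        : Set
    order    : ℕ
    enum     : V ↔ Fin order
    _~_      : V → V → Set
    _~?_     : B.Decidable _~_
    ~-sym    : Symmetric _~_
    ~-irrefl : Irreflexive _≡_ _~_

  open Inverse enum public using () renaming
    (to to index; from to vertex; strictlyInverseʳ to vertex∘index)

  _≟_ : DecidableEquality V
  _≟_ = Fin.inj⇒≟ (↔⇒↣ enum)

Connected : Graph → Set
Connected G = ∀ u v → Star _~_ u v
  where open Graph G

-- An edge is presented by any proof of adjacency of its ends, in either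
-- order; σ-undirected makes the sign independent of this presentation.
record SignedGraph : Set₁ where
  field
    graph : Graph
  open Graph graph public
  field
    σ            : ∀ {u v} → u ~ v → Sign
    σ-undirected : ∀ {u v} (p : u ~ v) (q : v ~ u) → σ p ≡ σ q

  σ-irrelevant : ∀ {u v} (p q : u ~ v) → σ p ≡ σ q
  σ-irrelevant p q = trans (σ-undirected p (~-sym p)) (σ-undirected (~-sym p) q)

HasNegativeEdge : SignedGraph → Set
HasNegativeEdge S = ∃[ u ] ∃[ v ] Σ[ p ∈ u ~ v ] σ p ≡ Sign.-
  where open SignedGraph S

AllPositive : SignedGraph → Set
AllPositive S = ∀ {u v} (p : u ~ v) → σ p ≡ Sign.+
  where open SignedGraph S

------------------------------------------------------------------------
-- Vector valued switching

data Ω : Set where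
  neg nil pos : Ω

⟦_⟧ : Ω → ℤ
⟦ neg ⟧ = -1ℤ
⟦ nil ⟧ = 0ℤ
⟦ pos ⟧ = 1ℤ

-- The standard inner product of ℝᵏ takes integer values on Ωᵏ.
⟨_,_⟩ : ∀ {k} → Vec Ω k → Vec Ω k → ℤ
⟨ []     , []     ⟩ = 0ℤ
⟨ x ∷ xs , y ∷ ys ⟩ = ⟦ x ⟧ ℤ.* ⟦ y ⟧ ℤ.+ ⟨ xs , ys ⟩

⟨⟩-comm : ∀ {k} (x y : Vec Ω k) → ⟨ x , y ⟩ ≡ ⟨ y , x ⟩
⟨⟩-comm []       []       = refl
⟨⟩-comm (x ∷ xs) (y ∷ ys) =
  cong₂ ℤ._+_ (ℤ.*-comm ⟦ x ⟧ ⟦ y ⟧) (⟨⟩-comm xs ys)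

record SwitchingFunction (S : SignedGraph) (k : ℕ) : Set where
  open SignedGraph S
  field
    ζ       : V → Vec Ω k
    nonzero : ∀ {u v} → u ~ v → ⟨ ζ u , ζ v ⟩ ≢ 0ℤ

-- The library's sign sends 0 to +, but here it is only applied to inner
-- products which are nonzero by SwitchingFunction.nonzero.
switch : (S : SignedGraph) {k : ℕ} → SwitchingFunction S k → SignedGraph
switch S s = record
  { graph        = graph
  ; σ            = λ {u} {v} p → σ p * sign ⟨ ζ u , ζ v ⟩
  ; σ-undirected = λ {u} {v} p q →
      cong₂ _*_ (σ-undirected p q) (cong sign (⟨⟩-comm (ζ u) (ζ v)))
  }
  where
  open SignedGraph S
  open SwitchingFunction s

Balanceable : SignedGraph → ℕ → Set
Balanceable S k = Σ[ s ∈ SwitchingFunction S k ] AllPositive (switch S s)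

------------------------------------------------------------------------
-- Balanceable is decidable

private
  Searchable : Set → Set₁
  Searchable A = ∀ {P : A → Set} → Decidable P → Dec (∃ P)

  Ω-searchable : Searchable Ω
  Ω-searchable P? = map′
    (λ { (inj₁ p) → neg , p ; (inj₂ (inj₁ p)) → nil , p ; (inj₂ (inj₂ p)) → pos , p })
    (λ { (neg , p) → inj₁ p ; (nil , p) → inj₂ (inj₁ p) ; (pos , p) → inj₂ (inj₂ p) })
    (P? neg ⊎-dec P? nil ⊎-dec P? pos)

  Vec-searchable : ∀ {A} → Searchable A → ∀ n → Searchable (Vec A n)
  Vec-searchable _  zero    P? = map′ ([] ,_) (λ { ([] , p) → p }) (P? [])
  Vec-searchable A? (suc n) P? = map′
    (λ { (x , xs , p) → x ∷ xs , p })
    (λ { (x ∷ xs , p) → x , xs , p })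
    (A? λ x → Vec-searchable A? n λ xs → P? (x ∷ xs))

balanceable? : ∀ S → Decidable (Balanceable S)
balanceable? S k = map′
  (λ (M , g) → record { ζ = decode M ; nonzero = λ {u} {v} p → proj₁ (g u v p) }
             , λ {u} {v} p → proj₂ (g u v p))
  (λ (s , all+) → let open SwitchingFunction s in
     encode ζ , λ u v p → subst₂ (GoodAt p) (sym (decode-encode ζ u)) (sym (decode-encode ζ v))
                            (nonzero p , all+ p))
  (Vec-searchable (Vec-searchable Ω-searchable k) order (good? ∘ decode))
  where
  open SignedGraph S

  decode : Vec (Vec Ω k) order → V → Vec Ω k
  decode M = lookup M ∘ index

  encode : (V → Vec Ω k) → Vec (Vec Ω k) order
  encode ζ = tabulate (ζ ∘ vertex)

  decode-encode : ∀ ζ v → decode (encode ζ) v ≡ ζ v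
  decode-encode ζ v = trans (lookup∘tabulate (ζ ∘ vertex) (index v)) (cong ζ (vertex∘index v))

  GoodAt : ∀ {u v} → u ~ v → Vec Ω k → Vec Ω k → Set
  GoodAt p x y = ⟨ x , y ⟩ ≢ 0ℤ × σ p * sign ⟨ x , y ⟩ ≡ Sign.+

  all-V? : {P : V → Set} → Decidable P → Dec (∀ v → P v)
  all-V? {P} P? = map′ (λ f v → subst P (vertex∘index v) (f (index v))) (λ f i → f (vertex i))
                       (Fin.all? (P? ∘ vertex))

  good? : ∀ ζ → Dec (∀ u v (p : u ~ v) → GoodAt p (ζ u) (ζ v))
  good? ζ = all-V? λ u → all-V? λ v → edge? u v
    where
    edge? : ∀ u v → Dec ((p : u ~ v) → GoodAt p (ζ u) (ζ v))
    edge? u v with u ~? v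
    ... | no ¬p = yes λ p → ⊥-elim (¬p p)
    ... | yes p = map′
      (λ (nz , eq) q → nz , trans (cong (_* _) (σ-irrelevant q p)) eq)
      (λ f → f p)
      (¬? (⟨ ζ u , ζ v ⟩ ℤ.≟ 0ℤ) ×-dec (σ p * sign ⟨ ζ u , ζ v ⟩ Sign.≟ Sign.+))

------------------------------------------------------------------------
-- Every signed graph is balanceable in some positive dimension: use one
-- coordinate for each ordered pair (a , b), equal to 1 at a and to
-- σ(ab) at b if ab is an edge, and 0 elsewhere.  An extra zero coordinate
-- keeps the dimension positive.

module _ (S : SignedGraph) where
  open SignedGraph S

  private
    fromSign : Sign → Ω
    fromSign Sign.- = neg
    fromSign Sign.+ = pos

    coord : V × V → V → Ω
    coord (a , b) w with a ~? b
    ... | no _  = nil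
    ... | yes e with w ≟ a | w ≟ b
    ...   | yes _ | _     = pos
    ...   | no _  | yes _ = fromSign (σ e)
    ...   | no _  | no _  = nil

    pairs : List (V × V)
    pairs = cartesianProduct (map vertex (allFin order)) (map vertex (allFin order))

    ∈-pairs : ∀ u v → (u , v) ∈ pairs
    ∈-pairs u v = ∈-cartesianProduct⁺ (∈-vs u) (∈-vs v)
      where
      ∈-vs : ∀ w → w ∈ map vertex (allFin order)
      ∈-vs w = subst (_∈ _) (vertex∘index w) (∈-map⁺ vertex (∈-allFin (index w)))

    ζ⟨_⟩ : (L : List (V × V)) → V → Vec Ω (length L)
    ζ⟨ []    ⟩ w = []
    ζ⟨ e ∷ L ⟩ w = coord e w ∷ ζ⟨ L ⟩ w

    pos*fromSign : ∀ s → ⟦ pos ⟧ ℤ.* ⟦ fromSign s ⟧ ≡ s ◃ 1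
    pos*fromSign Sign.- = refl
    pos*fromSign Sign.+ = refl

    fromSign*pos : ∀ s → ⟦ fromSign s ⟧ ℤ.* ⟦ pos ⟧ ≡ s ◃ 1
    fromSign*pos Sign.- = refl
    fromSign*pos Sign.+ = refl

    coord-* : ∀ {u v} (p : u ~ v) e →
      ∃[ c ] (⟦ coord e u ⟧ ℤ.* ⟦ coord e v ⟧ ≡ σ p ◃ c) × (e ≡ (u , v) → 1 ≤ c)
    coord-* {u} {v} p (a , b) with a ~? b
    ... | no ¬e = 0 , refl , λ { refl → ⊥-elim (¬e p) }
    ... | yes e with u ≟ a | u ≟ b | v ≟ a | v ≟ b
    ...   | yes refl | _        | yes refl | _        = ⊥-elim (~-irrefl refl p)
    ...   | yes refl | _        | no _     | yes refl =
            1 , trans (pos*fromSign (σ e)) (cong (_◃ 1) (σ-irrelevant e p)) , λ _ → s≤s z≤n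
    ...   | yes refl | _        | no _     | no v≢b   = 0 , refl , λ { refl → ⊥-elim (v≢b refl) }
    ...   | no u≢a   | yes refl | yes refl | _        =
            1 , trans (fromSign*pos (σ e)) (cong (_◃ 1) (σ-undirected e p)) , λ _ → s≤s z≤n
    ...   | no u≢a   | yes refl | no _     | yes refl = ⊥-elim (~-irrefl refl p)
    ...   | no u≢a   | yes refl | no _     | no _     =
            0 , ℤ.*-zeroʳ ⟦ fromSign (σ e) ⟧ , λ { refl → ⊥-elim (u≢a refl) }
    ...   | no u≢a   | no _     | _        | _        =
            0 , refl , λ { refl → ⊥-elim (u≢a refl) }

    ⟨ζ,ζ⟩ : ∀ {u v} (p : u ~ v) L →
      ∃[ c ] (⟨ ζ⟨ L ⟩ u , ζ⟨ L ⟩ v ⟩ ≡ σ p ◃ c) × ((u , v) ∈ L → 1 ≤ c)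
    ⟨ζ,ζ⟩ p []      = 0 , refl , λ ()
    ⟨ζ,ζ⟩ p (e ∷ L) with coord-* p e | ⟨ζ,ζ⟩ p L
    ... | c , eq , h | d , eq′ , h′ =
      c ℕ.+ d , trans (cong₂ ℤ._+_ eq eq′) (sym (ℤ.◃-distrib-+ (σ p) c d)) ,
      λ { (here refl) → ℕ.≤-trans (h refl) (ℕ.m≤m+n c d)
        ; (there m)   → ℕ.≤-trans (h′ m) (ℕ.m≤n+m d c) }

    ζ₀ : V → Vec Ω (suc (length pairs))
    ζ₀ w = nil ∷ ζ⟨ pairs ⟩ w

    ⟨ζ₀,ζ₀⟩ : ∀ {u v} (p : u ~ v) → ∃[ c ] ⟨ ζ₀ u , ζ₀ v ⟩ ≡ σ p ◃ suc c
    ⟨ζ₀,ζ₀⟩ {u} {v} p with ⟨ζ,ζ⟩ p pairs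
    ... | c     , eq , h with h (∈-pairs u v)
    ⟨ζ₀,ζ₀⟩ p | suc c , eq , _ | s≤s _ = c , trans (ℤ.+-identityˡ _) eq

    ◃-suc≢0 : ∀ s c → s ◃ suc c ≢ 0ℤ
    ◃-suc≢0 Sign.- c ()
    ◃-suc≢0 Sign.+ c ()

  balanceable-somewhere : ∃[ k ] 1 ≤ k × Balanceable S k
  balanceable-somewhere = suc (length pairs) , s≤s z≤n ,
    record
      { ζ       = ζ₀
      ; nonzero = λ p eq → let c , eq′ = ⟨ζ₀,ζ₀⟩ p in ◃-suc≢0 (σ p) c (trans (sym eq′) eq)
      } ,
    λ p → let c , eq = ⟨ζ₀,ζ₀⟩ p in
      trans (cong (σ p *_) (trans (cong sign eq) (ℤ.sign-◃ (σ p) (suc c)))) (Sign.s*s≡+ (σ p))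

------------------------------------------------------------------------
-- Balancing dimension

IsLeast : (ℕ → Set) → ℕ → Set
IsLeast P k = P k × (∀ j → P j → k ≤ j)

least : {P : ℕ → Set} → Decidable P → ∃ P → ∃ (IsLeast P)
least P? (n , p) = go P? n p
  where
  go : {P : ℕ → Set} → Decidable P → ∀ n → P n → ∃ (IsLeast P)
  go P? zero    p = zero , p , λ _ _ → z≤n
  go {P} P? (suc n) p with P? zero
  ... | yes p₀ = zero , p₀ , λ _ _ → z≤n
  ... | no ¬p₀ with go (P? ∘ suc) n p
  ...   | k , pk , min = suc k , pk , λ where
            zero    p₀ → ⊥-elim (¬p₀ p₀)
            (suc j) pj → s≤s (min j pj)

bdim-exists : ∀ S → ∃ (IsLeast λ k → 1 ≤ k × Balanceable S k)
bdim-exists S =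
  least (λ k → (1 ℕ.≤? k) ×-dec balanceable? S k) (balanceable-somewhere S)

bdim : SignedGraph → ℕ
bdim S = proj₁ (bdim-exists S)

bdim-isLeast : ∀ S → IsLeast (λ k → 1 ≤ k × Balanceable S k) (bdim S)
bdim-isLeast S = proj₂ (bdim-exists S)

------------------------------------------------------------------------
-- Lexicographic products

infix 10 _[_]ᴳ _[_]

_[_]ᴳ : Graph → Graph → Graph
G₁ [ G₂ ]ᴳ = record
  { V        = G₁.V × G₂.V
  ; order    = G₁.order ℕ.* G₂.order
  ; enum     = ↔-sym Fin.*↔× ↔-∘ (G₁.enum ×-↔ G₂.enum)
  ; _~_      = λ (u , v) (u′ , v′) → u G₁.~ u′ ⊎ (u ≡ u′ × v G₂.~ v′)
  ; _~?_     = λ (u , v) (u′ , v′) →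
      (u G₁.~? u′) ⊎-dec ((u G₁.≟ u′) ×-dec (v G₂.~? v′))
  ; ~-sym    = λ where
      (inj₁ p)          → inj₁ (G₁.~-sym p)
      (inj₂ (refl , q)) → inj₂ (refl , G₂.~-sym q)
  ; ~-irrefl = λ where
      refl (inj₁ p)       → G₁.~-irrefl refl p
      refl (inj₂ (_ , q)) → G₂.~-irrefl refl q
  }
  where
  module G₁ = Graph G₁
  module G₂ = Graph G₂

-- The two kinds of adjacency exclude each other, as G₁ has no loops: the
-- first occurs only for distinct first coordinates, the second only for
-- equal ones.
_[_] : SignedGraph → SignedGraph → SignedGraph
S₁ [ S₂ ] = record
  { graph        = S₁.graph [ S₂.graph ]ᴳ
  ; σ            = λ where
      (inj₁ p)       → S₁.σ p
      (inj₂ (_ , q)) → S₂.σ q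
  ; σ-undirected = λ where
      (inj₁ p)       (inj₁ p′)       → S₁.σ-undirected p p′
      (inj₁ p)       (inj₂ (eq , _)) → ⊥-elim (S₁.~-irrefl (sym eq) p)
      (inj₂ (eq , _)) (inj₁ p)       → ⊥-elim (S₁.~-irrefl (sym eq) p)
      (inj₂ (_ , q)) (inj₂ (_ , q′)) → S₂.σ-undirected q q′
  }
  where
  module S₁ = SignedGraph S₁
  module S₂ = SignedGraph S₂

{-# OPTIONS --safe #-}

-- Two vectors x, y of ℝ² at an obtuse angle bound an acute cone of vectors
-- having positive inner product with both.  So no two pairs x, y and p, q,
-- each at an obtuse angle, have all four cross products nonzero and of one
-- sign.  The copies of a negative edge of Σ₂ over the two ends of an edge of
-- Σ₁ would give such pairs if the product were balanceable in dimension 2;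
-- and dimension k embeds into dimension k + 1.
module Submission where

open import Defs
open import Data.Fin using (zero; suc)
open import Data.Fin.Properties using (0≢1+n)
open import Data.Integer
  using (ℤ; 0ℤ; +0; +[1+_]; -[1+_]; _+_; _*_; -_; sign; _≤_; _<_; +≤+; +<+; -<+; positive; nonNegative)
open import Data.Integer.Properties
  using (+-identityˡ; *-zeroʳ; +-mono-≤; +-mono-<; +-mono-≤-<; *-monoˡ-≤-nonNeg; *-monoˡ-<-pos; neg-mono-<; <⇒≤; ≤⇒≯)
open import Data.Integer.Tactic.RingSolver using (solve-∀)
open import Data.Nat as ℕ using (_≥_; z≤n; s≤s; _≤′_; ≤′-refl; ≤′-step)
import Data.Nat.Properties as ℕ
open import Data.Product using (∃-syntax; _×_; _,_)
open import Data.Sign as Sign using (Sign)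
import Data.Sign.Properties as Sign
open import Data.Sum using (inj₁; inj₂)
open import Data.Vec using (Vec; []; _∷_)
open import Function using (Inverse; _∘_)
open import Relation.Binary.Construct.Closure.ReflexiveTransitive using (Star; ε; _◅_)
open import Relation.Binary.PropositionalEquality using (_≡_; _≢_; refl; sym; trans; cong; subst)
open import Relation.Nullary using (¬_; contradiction)

0≤i*j : ∀ {i j} → 0ℤ ≤ i → 0ℤ ≤ j → 0ℤ ≤ i * j
0≤i*j {i} {j} 0≤i 0≤j = subst (_≤ i * j) (*-zeroʳ i) (*-monoˡ-≤-nonNeg i {{nonNegative 0≤i}} 0≤j)

0<i*j : ∀ {i j} → 0ℤ < i → 0ℤ < j → 0ℤ < i * j
0<i*j {i} {j} 0<i 0<j = subst (_< i * j) (*-zeroʳ i) (*-monoˡ-<-pos i {{positive 0<i}} 0<j)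

0≤i*i : ∀ i → 0ℤ ≤ i * i
0≤i*i +0       = +≤+ z≤n
0≤i*i +[1+ _ ] = +≤+ z≤n
0≤i*i -[1+ _ ] = +≤+ z≤n

-- Zero needs no separate exclusion: `sign` sends it to plus.
sign-⇒<0 : ∀ {i} → sign i ≡ Sign.- → i < 0ℤ
sign-⇒<0 { -[1+ _ ]} _ = -<+

-- The first component is there because `sign` alone cannot tell zero from a positive integer.
HasSign : Sign → ℤ → Set
HasSign s i = i ≢ 0ℤ × sign i ≡ s

sameSign⇒0<* : ∀ {s i j} → HasSign s i → HasSign s j → 0ℤ < i * j
sameSign⇒0<* {i = +0}       (i≢0 , _)  _          = contradiction refl i≢0
sameSign⇒0<* {j = +0}       _          (j≢0 , _)  = contradiction refl j≢0
sameSign⇒0<* {i = +[1+ _ ]} {+[1+ _ ]} _ _        = +<+ (s≤s z≤n)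
sameSign⇒0<* {i = -[1+ _ ]} { -[1+ _ ]} _ _       = +<+ (s≤s z≤n)
sameSign⇒0<* {i = +[1+ _ ]} { -[1+ _ ]} (_ , refl) (_ , ())
sameSign⇒0<* {i = -[1+ _ ]} {+[1+ _ ]}  (_ , refl) (_ , ())

-- Cramer's rule for p and q in terms of x and y, with the determinant
-- cleared: the inverse Gram matrix of (x , y), applied to the inner products
-- of p and q with x and y.  The summand + 0ℤ is the one in ⟨_,_⟩.
gram-identity : ∀ x₁ x₂ y₁ y₂ p₁ p₂ q₁ q₂ →
  let infix 8 ⟪_,_∣_,_⟫
      ⟪_,_∣_,_⟫ : ℤ → ℤ → ℤ → ℤ → ℤ
      ⟪ a , b ∣ c , d ⟫ = a * c + (b * d + 0ℤ)
      det = x₁ * y₂ + - (x₂ * y₁)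
  in det * det * ⟪ p₁ , p₂ ∣ q₁ , q₂ ⟫ ≡
     ⟪ y₁ , y₂ ∣ y₁ , y₂ ⟫ * (⟪ x₁ , x₂ ∣ p₁ , p₂ ⟫ * ⟪ x₁ , x₂ ∣ q₁ , q₂ ⟫) +
     ⟪ x₁ , x₂ ∣ x₁ , x₂ ⟫ * (⟪ y₁ , y₂ ∣ p₁ , p₂ ⟫ * ⟪ y₁ , y₂ ∣ q₁ , q₂ ⟫) +
     - ⟪ x₁ , x₂ ∣ y₁ , y₂ ⟫ *
       (⟪ x₁ , x₂ ∣ p₁ , p₂ ⟫ * ⟪ y₁ , y₂ ∣ q₁ , q₂ ⟫ + ⟪ y₁ , y₂ ∣ p₁ , p₂ ⟫ * ⟪ x₁ , x₂ ∣ q₁ , q₂ ⟫)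
gram-identity = solve-∀

0≤⟨x,x⟩ : ∀ {k} (x : Vec Ω k) → 0ℤ ≤ ⟨ x , x ⟩
0≤⟨x,x⟩ []       = +≤+ z≤n
0≤⟨x,x⟩ (x ∷ xs) = +-mono-≤ (0≤i*i ⟦ x ⟧) (0≤⟨x,x⟩ xs)

-- If both pairs were obtuse, the two sides of `gram-identity` would disagree in sign. On the right,
-- all products of cross terms are positive, so the two summands weighted by squared norms are
-- nonnegative and the one weighted by `- ⟨ x , y ⟩` is strictly positive.
obtuse-pairs : ∀ {s} (x y p q : Vec Ω 2) → ⟨ x , y ⟩ < 0ℤ →
  HasSign s ⟨ x , p ⟩ → HasSign s ⟨ x , q ⟩ → HasSign s ⟨ y , p ⟩ → HasSign s ⟨ y , q ⟩ →
  ¬ ⟨ p , q ⟩ < 0ℤ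
obtuse-pairs x@(x₁ ∷ x₂ ∷ []) y@(y₁ ∷ y₂ ∷ []) p@(p₁ ∷ p₂ ∷ []) q@(q₁ ∷ q₂ ∷ []) xy<0 xp xq yp yq pq<0 =
  ≤⇒≯ lhs≤0 (subst (0ℤ <_) (sym identity) 0<rhs)
  where
  det : ℤ
  det = ⟦ x₁ ⟧ * ⟦ y₂ ⟧ + - (⟦ x₂ ⟧ * ⟦ y₁ ⟧)

  identity : det * det * ⟨ p , q ⟩ ≡
    ⟨ y , y ⟩ * (⟨ x , p ⟩ * ⟨ x , q ⟩) + ⟨ x , x ⟩ * (⟨ y , p ⟩ * ⟨ y , q ⟩) +
    - ⟨ x , y ⟩ * (⟨ x , p ⟩ * ⟨ y , q ⟩ + ⟨ y , p ⟩ * ⟨ x , q ⟩)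
  identity = gram-identity ⟦ x₁ ⟧ ⟦ x₂ ⟧ ⟦ y₁ ⟧ ⟦ y₂ ⟧ ⟦ p₁ ⟧ ⟦ p₂ ⟧ ⟦ q₁ ⟧ ⟦ q₂ ⟧

  lhs≤0 : det * det * ⟨ p , q ⟩ ≤ 0ℤ
  -- Only a weak bound holds, since `det` vanishes when `x` and `y` are parallel. Strictness comes
  -- from the right side, so this case needs no separate treatment.
  lhs≤0 = subst (det * det * ⟨ p , q ⟩ ≤_) (*-zeroʳ (det * det))
    (*-monoˡ-≤-nonNeg (det * det) {{nonNegative (0≤i*i det)}} (<⇒≤ pq<0))

  0<rhs : 0ℤ <
    ⟨ y , y ⟩ * (⟨ x , p ⟩ * ⟨ x , q ⟩) + ⟨ x , x ⟩ * (⟨ y , p ⟩ * ⟨ y , q ⟩) +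
    - ⟨ x , y ⟩ * (⟨ x , p ⟩ * ⟨ y , q ⟩ + ⟨ y , p ⟩ * ⟨ x , q ⟩)
  0<rhs = +-mono-≤-<
    (+-mono-≤ (0≤i*j (0≤⟨x,x⟩ y) (<⇒≤ (sameSign⇒0<* xp xq)))
              (0≤i*j (0≤⟨x,x⟩ x) (<⇒≤ (sameSign⇒0<* yp yq))))
    (0<i*j (neg-mono-< xy<0) (+-mono-< (sameSign⇒0<* xp yq) (sameSign⇒0<* yp xq)))

module _ (S : SignedGraph) where
  open SignedGraph S

  -- Every sign is its own inverse, so a product equal to plus forces equal factors.
  balanced⇒HasSign : ∀ {k} ((s , _) : Balanceable S k) → let open SwitchingFunction s in
    ∀ {u v} (e : u ~ v) → HasSign (σ e) ⟨ ζ u , ζ v ⟩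
  balanced⇒HasSign (s , all+) e = nonzero e ,
    Sign.*-cancelˡ-≡ (σ e) _ _ (trans (all+ e) (sym (Sign.s*s≡+ (σ e))))
    where open SwitchingFunction s

  -- Prepending a zero coordinate leaves all inner products unchanged.
  balanceable-suc : ∀ {k} → Balanceable S k → Balanceable S (ℕ.suc k)
  balanceable-suc (s , all+) =
    record
      { ζ       = λ u → nil ∷ ζ u
      ; nonzero = λ e eq → nonzero e (trans (sym (+-identityˡ _)) eq)
      } ,
    λ e → trans (cong (λ i → σ e Sign.* sign i) (+-identityˡ _)) (all+ e)
    where open SwitchingFunction s

  balanceable-mono : ∀ {j k} → j ≤′ k → Balanceable S j → Balanceable S k
  balanceable-mono ≤′-refl        = λ b → b
  balanceable-mono (≤′-step j≤′k) = balanceable-suc ∘ balanceable-mono j≤′k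

star⇒edge : ∀ {A : Set} {R : A → A → Set} {x y} → Star R x y → x ≢ y → ∃[ u ] ∃[ v ] R u v
star⇒edge ε       x≢x = contradiction refl x≢x
star⇒edge (r ◅ _) _   = _ , _ , r

-- The vertices numbered 0 and 1 are distinct because `enum` is a bijection, so a walk joining them
-- has a first edge.
connected⇒edge : ∀ G → let open Graph G in Connected G → order ≥ 2 → ∃[ u ] ∃[ v ] u ~ v
connected⇒edge record { enum = enum } connected (s≤s (s≤s z≤n)) =
  star⇒edge (connected (from zero) (from (suc zero))) λ eq →
    0≢1+n (trans (sym (strictlyInverseˡ zero)) (trans (cong to eq) (strictlyInverseˡ (suc zero))))
  where open Inverse enum

product-not-balanceable₂ : ∀ Σ₁ Σ₂ → ∃[ a ] ∃[ b ] SignedGraph._~_ Σ₁ a b → HasNegativeEdge Σ₂ →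
  ¬ Balanceable (Σ₁ [ Σ₂ ]) 2
product-not-balanceable₂ Σ₁ Σ₂ (a , b , ab) (v , w , vw , σvw≡-) β@(s , _) =
  obtuse-pairs (ζ (a , v)) (ζ (a , w)) (ζ (b , v)) (ζ (b , w))
    (obtuse a) (cross v v) (cross v w) (cross w v) (cross w w) (obtuse b)
  where
  open SwitchingFunction s

  obtuse : ∀ c → ⟨ ζ (c , v) , ζ (c , w) ⟩ < 0ℤ
  obtuse c with balanced⇒HasSign (Σ₁ [ Σ₂ ]) β {c , v} {c , w} (inj₂ (refl , vw))
  ... | _ , eq = sign-⇒<0 (trans eq σvw≡-)

  -- The sign of an edge between the two copies depends only on `ab`, so all four cross products
  -- share it.
  cross : ∀ x y → HasSign (SignedGraph.σ Σ₁ ab) ⟨ ζ (a , x) , ζ (b , y) ⟩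
  cross x y = balanced⇒HasSign (Σ₁ [ Σ₂ ]) β {a , x} {b , y} (inj₁ ab)

theorem2p11 : (Σ₁ Σ₂ : SignedGraph)
    → Connected (SignedGraph.graph Σ₁)
    → Connected (SignedGraph.graph Σ₂)
    → SignedGraph.order Σ₁ ≥ 2
    → HasNegativeEdge Σ₂
    → bdim (Σ₁ [ Σ₂ ]) ≥ 3
theorem2p11 Σ₁ Σ₂ connected₁ _ order≥2 negative₂ = ℕ.≰⇒> λ bdim≤2 →
  let ((_ , balanceable) , _) = bdim-isLeast (Σ₁ [ Σ₂ ]) in
  product-not-balanceable₂ Σ₁ Σ₂ (connected⇒edge (SignedGraph.graph Σ₁) connected₁ order≥2) negative₂
    -- The least dimension may be 1, so it is raised to exactly 2, where the planar argument
    -- applies.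
    (balanceable-mono (Σ₁ [ Σ₂ ]) (ℕ.≤⇒≤′ bdim≤2) balanceable)
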